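{- Let $a,b$ be positive integers and let $\{F_n(q)\}_{n\geq 0}$ be the $q$-biperiodic Fibonacci sequence. For every integer $n\geq 0$, $$\sum_{k=1}^{n+1}q^kF_k(q)\,a^{\xi(n)\xi(k)}\,b^{\xi(k+1)-\xi(n)\xi(k+1)}\,(ab)^{\left\lfloor\frac{n-k+1}{2}\right\rfloor}=F_{n+3}(q)-a^{\xi(n)}(ab)^{\left\lfloor\frac{n+2}{2}\right\rfloor}.$$
   Context: Fix positive integers $a,b$; $q$ is an indeterminate. The $q$-biperiodic Fibonacci sequence is defined by $F_0(q)=0$, $F_1(q)=1$ and, for $n\geq 2$, $F_n(q)=aF_{n-1}(q)+q^{n-2}F_{n-2}(q)$ if $n$ is even, $F_n(q)=bF_{n-1}(q)+q^{n-2}F_{n-2}(q)$ if $n$ is odd. For an integer $n$, $\xi(n)=n-2\lfloor n/2\rfloor$ (so $\xi(n)=0$ if $n$ is even and $1$ if $n$ is odd). -}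

module Defs where

open import Algebra.Bundles.Raw using (RawRing)
open import Data.Fin.Base using (toℕ)
open import Data.Integer.Base as ℤ using (ℤ; +_; 0ℤ; 1ℤ)
open import Data.List.Base using (List; []; _∷_; map)
open import Data.Nat.Base as ℕ using (ℕ; zero; suc; ⌊_/2⌋; parity)
open import Data.Parity.Base using (0ℙ; 1ℙ)
open import Level using (0ℓ)
open import Relation.Binary.PropositionalEquality.Core using (_≡_)

-- Coefficient lists, constant term first.  Trailing zeros are allowed, so
-- equality of polynomials is _≈_ below, not _≡_.
ℤ[q] : Set
ℤ[q] = List ℤ

coeff : ℤ[q] → ℕ → ℤ
coeff []      _       = 0ℤ
coeff (c ∷ _) zero    = c
coeff (_ ∷ f) (suc i) = coeff f i

infix 4 _≈ᴾ_
infixl 6 _+ᴾ_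
infixl 7 _*ᴾ_

_≈ᴾ_ : ℤ[q] → ℤ[q] → Set
f ≈ᴾ g = ∀ i → coeff f i ≡ coeff g i

_+ᴾ_ : ℤ[q] → ℤ[q] → ℤ[q]
[]      +ᴾ g       = g
(c ∷ f) +ᴾ []      = c ∷ f
(c ∷ f) +ᴾ (d ∷ g) = (c ℤ.+ d) ∷ (f +ᴾ g)

-- (c + q f) g = c g + q (f g)
_*ᴾ_ : ℤ[q] → ℤ[q] → ℤ[q]
[]      *ᴾ g = []
(c ∷ f) *ᴾ g = map (c ℤ.*_) g +ᴾ (0ℤ ∷ (f *ᴾ g))

ℤ[q]-rawRing : RawRing 0ℓ 0ℓ
ℤ[q]-rawRing = record
  { Carrier = ℤ[q]
  ; _≈_     = _≈ᴾ_
  ; _+_     = _+ᴾ_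
  ; _*_     = _*ᴾ_
  ; -_      = map (ℤ.-_)
  ; 0#      = []
  ; 1#      = 1ℤ ∷ []
  }

open RawRing ℤ[q]-rawRing public using (_≈_; _+_; _*_; -_; 0#; 1#)
open import Algebra.Definitions.RawSemiring (RawRing.rawSemiring ℤ[q]-rawRing) public
  using (_^_; sum)

infixl 6 _-_

_-_ : ℤ[q] → ℤ[q] → ℤ[q]
f - g = f + (- g)

q : ℤ[q]
q = 0ℤ ∷ 1ℤ ∷ []

const : ℕ → ℤ[q]
const c = (+ c) ∷ []

-- The sum of f k over 1 ≤ k ≤ m.
∑₁ : (m : ℕ) → (ℕ → ℤ[q]) → ℤ[q]
∑₁ m f = sum {m} (λ i → f (suc (toℕ i)))

infixl 6 ∑₁
syntax ∑₁ m (λ k → x) = ∑[1≤ k ≤ m ] x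

-- 2⌊n/2⌋ ≤ n, so the subtraction is never truncated.
ξ : ℕ → ℕ
ξ n = n ℕ.∸ 2 ℕ.* ⌊ n /2⌋

leading : (a b n : ℕ) → ℕ
leading a b n with parity n
... | 0ℙ = a
... | 1ℙ = b

F : (a b : ℕ) → ℕ → ℤ[q]
F a b zero            = 0#
F a b (suc zero)      = 1#
F a b n@(suc (suc m)) = const (leading a b n) * F a b (suc m) + q ^ m * F a b m

{-# OPTIONS --safe #-}

-- Unrolling F (n + 3) = c F (n + 2) + q ^ (n + 1) F (n + 1), where c alternates
-- between a and b, gives q ^ k F k for each k, multiplied by the n + 1 - k
-- coefficients c met after it, and F 2 = a multiplied by all of them.
-- Such a product of alternating factors is a monomial in a and b that depends only
-- on the number of factors and on the parity of n.

module Submission where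

open import Algebra.Bundles using (CommutativeSemiring; CommutativeRing; AbelianGroup)
import Algebra.Construct.Pointwise as Pointwise
import Algebra.Definitions.RawSemiring as RawSemiringDefinitions
import Algebra.Morphism.GroupMonomorphism as GroupMonomorphism
import Algebra.Morphism.RingMonomorphism as RingMonomorphism
import Algebra.Properties.CommutativeSemigroup as CommutativeSemigroupProperties
import Algebra.Properties.Group as GroupProperties
import Algebra.Properties.Semiring.Sum as SemiringSum
open import Algebra.Structures using (IsAbelianGroup; IsCommutativeRing)
open import Data.Fin.Base using (Fin; toℕ; inject₁; fromℕ)
open import Data.Fin.Properties using (toℕ-inject₁; toℕ-fromℕ; toℕ<n)
open import Data.Integer.Base as ℤ using (ℤ; 0ℤ; 1ℤ)
import Data.Integer.Properties as ℤ
open import Data.List.Base using ([]; _∷_; map)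
open import Data.Nat.Base as ℕ using (ℕ; zero; suc; NonZero; ⌊_/2⌋; parity)
import Data.Nat.Properties as ℕ
open import Data.Parity.Base as ℙ using (Parity; 0ℙ; 1ℙ; _⁻¹)
import Data.Parity.Properties as ℙ
open import Data.Product.Base using (_,_)
open import Function.Base using (id)
open import Level using (0ℓ)
open import Relation.Binary.PropositionalEquality as ≡ using (_≡_)
import Relation.Binary.Reasoning.Setoid as SetoidReasoning

open import Defs using (ξ)

-- Parities of indices.

bit : Parity → ℕ
bit 0ℙ = 0
bit 1ℙ = 1

-- Exponents written through `bit` compute once the parities are known, so identities between them
-- reduce to finitely many cases.
ξ≡bit : ∀ n → ξ n ≡ bit (parity n)
ξ≡bit 0 = ≡.refl
ξ≡bit 1 = ≡.refl
ξ≡bit (suc (suc n)) rewrite ℕ.+-suc ⌊ n /2⌋ (⌊ n /2⌋ ℕ.+ 0) = ξ≡bit n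

parity-suc : ∀ n → parity (suc n) ≡ parity n ⁻¹
parity-suc n = ≡.sym (ℙ.⁻¹-selfInverse (ℙ.suc-homo-⁻¹ n))

-- A parity added to itself vanishes. This recovers the parity of `k` from that of `m` and the
-- number of factors `m ∸ k`.
parity-∸ : ∀ {m k} → k ℕ.≤ m → parity m ℙ.+ parity (m ℕ.∸ k) ≡ parity k
parity-∸ {m} {k} k≤m = begin
  parity m ℙ.+ d                 ≡⟨ ≡.cong (λ i → parity i ℙ.+ d) (ℕ.m+[n∸m]≡n k≤m) ⟨
  parity (k ℕ.+ (m ℕ.∸ k)) ℙ.+ d ≡⟨ ≡.cong (ℙ._+ d) (ℙ.+-homo-+ k (m ℕ.∸ k)) ⟩
  parity k ℙ.+ d ℙ.+ d           ≡⟨ ℙ.+-assoc (parity k) d d ⟩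
  parity k ℙ.+ (d ℙ.+ d)         ≡⟨ ≡.cong (parity k ℙ.+_) (ℙ.p+p≡0ℙ d) ⟩
  parity k ℙ.+ 0ℙ                ≡⟨ ℙ.+-identityʳ (parity k) ⟩
  parity k                       ∎
  where
  open ≡.≡-Reasoning
  d = parity (m ℕ.∸ k)

-- Alternating products and linear recurrences over a commutative semiring.

module _ {c ℓ} (R : CommutativeSemiring c ℓ) where
  open CommutativeSemiring R
  open RawSemiringDefinitions rawSemiring using (_^_)
  open SemiringSum semiring using (sum; sum-cong-≋; sum-init-last; *-distribˡ-sum)
  open CommutativeSemigroupProperties *-commutativeSemigroup using (x∙yz≈y∙xz)
  open SetoidReasoning setoid

  module Alternating (x y : Carrier) where

    factor : Parity → Carrier
    factor 0ℙ = x
    factor 1ℙ = y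

    -- The first factor is the coefficient met last: for `k ≤ m`, `alternating (parity m) (m ∸ k)`
    -- runs through the coefficients of index `m` down to `k + 1`.
    alternating : Parity → ℕ → Carrier
    alternating p zero    = 1#
    alternating p (suc d) = factor p * alternating (p ⁻¹) d

    factor-pair : ∀ p z → factor p * (factor (p ⁻¹) * z) ≈ x * y * z
    factor-pair 0ℙ z = sym (*-assoc x y z)
    factor-pair 1ℙ z = trans (x∙yz≈y∙xz y x z) (sym (*-assoc x y z))

    -- With p and r the parities of n and k, and h = ⌊ (n + 1 - k) / 2 ⌋, this is the weight of q ^ k F k.
    monomial : Parity → Parity → ℕ → Carrier
    monomial p r h = x ^ (bit p ℕ.* bit r) * y ^ (bit (r ⁻¹) ℕ.∸ bit p ℕ.* bit (r ⁻¹)) * (x * y) ^ h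

    -- Two consecutive factors contribute one `x * y`, so the induction descends by two to zero or
    -- one factor. If `p` is the parity of `n + 1` and `d = n + 1 - k`, then `p ℙ.+ parity d` is the
    -- parity of `k`.
    alternating≈monomial : ∀ p d → alternating p d ≈ monomial (p ⁻¹) (p ℙ.+ parity d) ⌊ d /2⌋
    alternating≈monomial 0ℙ 0 = sym (trans (*-identityʳ _) (*-identityʳ _))
    alternating≈monomial 1ℙ 0 = sym (trans (*-identityʳ _) (*-identityʳ _))
    alternating≈monomial 0ℙ 1 = sym (trans (*-identityʳ _) (*-identityʳ _))
    alternating≈monomial 1ℙ 1 = sym (trans (*-identityʳ _) (*-identityˡ _))
    alternating≈monomial p (suc (suc d)) = begin
      factor p * (factor (p ⁻¹) * alternating (p ⁻¹ ⁻¹) d)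
        ≈⟨ factor-pair p _ ⟩
      x * y * alternating (p ⁻¹ ⁻¹) d
        ≡⟨ ≡.cong (λ s → x * y * alternating s d) (ℙ.⁻¹-involutive p) ⟩
      x * y * alternating p d
        ≈⟨ *-congˡ (alternating≈monomial p d) ⟩
      x * y * monomial (p ⁻¹) (p ℙ.+ parity d) ⌊ d /2⌋
        ≈⟨ x∙yz≈y∙xz _ _ _ ⟩
      monomial (p ⁻¹) (p ℙ.+ parity d) ⌊ suc (suc d) /2⌋
        ∎

    alternating-suc : ∀ m d → alternating (parity (suc m)) (suc d) ≈ factor (parity (suc m)) * alternating (parity m) d
    alternating-suc m d = *-congˡ (reflexive (≡.cong (λ s → alternating s d) (ℙ.suc-homo-⁻¹ m)))

    -- Multiplying by the next coefficient prepends it to every product, and the new value of `u`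
    -- enters with the empty product. The initial value `x` is itself the factor of index 0, whence
    -- the `suc m` factors of the remainder.
    unroll : (G u : ℕ → Carrier) → G 0 ≈ x →
             (∀ m → G (suc m) ≈ factor (parity (suc m)) * G m + u (suc m)) →
             ∀ m → G m ≈ sum {m} (λ i → u (suc (toℕ i)) * alternating (parity m) (m ℕ.∸ suc (toℕ i)))
                       + alternating (parity m) (suc m)
    unroll G u G₀ G₊ zero = trans G₀ (sym (trans (+-identityˡ _) (*-identityʳ x)))
    unroll G u G₀ G₊ (suc m) = begin
      G (suc m)
        ≈⟨ G₊ m ⟩
      f * G m + u (suc m)
        ≈⟨ +-congʳ (*-congˡ (unroll G u G₀ G₊ m)) ⟩
      f * (sum (t m) + z) + u (suc m)
        ≈⟨ +-cong (distribˡ f _ _) (sym last-term) ⟩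
      f * sum (t m) + f * z + t (suc m) (fromℕ m)
        ≈⟨ +-congʳ (+-cong (trans (*-distribˡ-sum f (t m)) (sum-cong-≋ init-term)) (sym (alternating-suc m (suc m)))) ⟩
      s + z′ + t (suc m) (fromℕ m)
        ≈⟨ xy∙z≈xz∙y s z′ _ ⟩
      s + t (suc m) (fromℕ m) + z′
        ≈⟨ +-congʳ (sum-init-last (t (suc m))) ⟨
      sum (t (suc m)) + z′
        ∎
      where
      open CommutativeSemigroupProperties +-commutativeSemigroup using (xy∙z≈xz∙y)
      f  = factor (parity (suc m))
      z  = alternating (parity m) (suc m)
      z′ = alternating (parity (suc m)) (suc (suc m))

      t : ∀ l → Fin l → Carrier
      t l i = u (suc (toℕ i)) * alternating (parity l) (l ℕ.∸ suc (toℕ i))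

      s = sum {m} (λ i → t (suc m) (inject₁ i))

      last-term : t (suc m) (fromℕ m) ≈ u (suc m)
      last-term rewrite toℕ-fromℕ m | ℕ.n∸n≡0 m = *-identityʳ _

      init-term : ∀ i → f * t m i ≈ t (suc m) (inject₁ i)
      -- Since `toℕ i < m`, the count `m ∸ toℕ i` is a successor; in that form `alternating` exposes
      -- its first factor.
      init-term i rewrite toℕ-inject₁ i | ≡.sym (ℕ.suc-pred (m ℕ.∸ toℕ i) {{ℕ.>-nonZero (ℕ.m<n⇒0<n∸m (toℕ<n i))}})
                        | ℕ.pred[m∸n]≡m∸[1+n] m (toℕ i) =
        trans (x∙yz≈y∙xz f _ _) (*-congˡ (sym (alternating-suc m (m ℕ.∸ suc (toℕ i)))))

    *-monomial : ∀ t n k → k ℕ.≤ suc n →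
      t * x ^ (ξ n ℕ.* ξ k) * y ^ (ξ (k ℕ.+ 1) ℕ.∸ ξ n ℕ.* ξ (k ℕ.+ 1)) * (x * y) ^ ⌊ suc n ℕ.∸ k /2⌋
      ≈ t * alternating (parity (suc n)) (suc n ℕ.∸ k)
    *-monomial t n k k≤1+n
      -- All parities are expressed through those of `suc n` and `suc n ∸ k`, the form in which
      -- `alternating≈monomial` applies.
      rewrite ξ≡bit n | ξ≡bit k | ℕ.+-comm k 1 | ξ≡bit (suc k) | parity-suc k
            | ≡.sym (parity-∸ k≤1+n) | ≡.sym (ℙ.suc-homo-⁻¹ n) =
      trans (*-congʳ (*-assoc t _ _)) (trans (*-assoc t _ _)
        (*-congˡ (sym (alternating≈monomial (parity (suc n)) (suc n ℕ.∸ k)))))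

    -- The contribution of the initial value has `n + 2` factors, as if `k` were -1. That index is
    -- odd, so the exponent of `y` is zero and that of `x` is `ξ n`.
    ^-ξ-* : ∀ n → x ^ ξ n * (x * y) ^ ⌊ suc (suc n) /2⌋ ≈ alternating (parity (suc n)) (suc (suc n))
    ^-ξ-* n rewrite ξ≡bit n | parity-suc n with parity n | alternating≈monomial (parity n ⁻¹) (suc (suc n))
    ... | 0ℙ | eq = sym (trans eq (*-congʳ (*-identityʳ _)))
    ... | 1ℙ | eq = sym (trans eq (*-congʳ (*-identityʳ _)))

-- The summation identity over a commutative ring.

module _ {c ℓ} (R : CommutativeRing c ℓ) where
  open CommutativeRing R
  open RawSemiringDefinitions (CommutativeSemiring.rawSemiring commutativeSemiring) using (_^_)
  open SemiringSum semiring using (sum; sum-cong-≋)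
  open GroupProperties +-group using (//-rightDividesʳ)
  open SetoidReasoning setoid

  module _ (x y z : Carrier) where
    open Alternating commutativeSemiring x y

    -- The recurrence is unrolled from index 2 up to index `n + 3`, and the contribution of `G 2` is
    -- moved across by subtraction.
    biperiodic-sum : (G : ℕ → Carrier) → G 2 ≈ x →
      (∀ m → G (suc (suc (suc m))) ≈ factor (parity (suc m)) * G (suc (suc m)) + z ^ suc m * G (suc m)) →
      ∀ n → sum {suc n} (λ i → let k = suc (toℕ i) in
          z ^ k * G k
          * x ^ (ξ n ℕ.* ξ k)
          * y ^ (ξ (k ℕ.+ 1) ℕ.∸ ξ n ℕ.* ξ (k ℕ.+ 1))
          * (x * y) ^ ⌊ suc n ℕ.∸ k /2⌋)
        ≈ G (suc (suc (suc n))) - x ^ ξ n * (x * y) ^ ⌊ suc (suc n) /2⌋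
    biperiodic-sum G G₂ G₊ n = begin
      sum {suc n} (λ i → m (suc (toℕ i)))
        ≈⟨ sum-cong-≋ (λ i → *-monomial (u (suc (toℕ i))) n (suc (toℕ i)) (toℕ<n i)) ⟩
      s
        ≈⟨ //-rightDividesʳ e s ⟨
      s + e - e
        ≈⟨ +-cong (unroll (λ l → G (suc (suc l))) u G₂ G₊ (suc n)) (-‿cong (^-ξ-* n)) ⟨
      G (suc (suc (suc n))) - x ^ ξ n * (x * y) ^ ⌊ suc (suc n) /2⌋
        ∎
      where
      u m : ℕ → Carrier
      u k = z ^ k * G k
      m k = u k * x ^ (ξ n ℕ.* ξ k) * y ^ (ξ (k ℕ.+ 1) ℕ.∸ ξ n ℕ.* ξ (k ℕ.+ 1)) * (x * y) ^ ⌊ suc n ℕ.∸ k /2⌋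

      s = sum {suc n} (λ i → let k = suc (toℕ i) in u k * alternating (parity (suc n)) (suc n ℕ.∸ k))
      e = alternating (parity (suc n)) (suc (suc n))

-- The commutative ring of integer polynomials.

open import Defs

coeff-+ : ∀ f g i → coeff (f + g) i ≡ coeff f i ℤ.+ coeff g i
coeff-+ []      g       i       = ≡.sym (ℤ.+-identityˡ _)
coeff-+ (c ∷ f) []      i       = ≡.sym (ℤ.+-identityʳ _)
coeff-+ (c ∷ f) (d ∷ g) zero    = ≡.refl
coeff-+ (c ∷ f) (d ∷ g) (suc i) = coeff-+ f g i

-- Coefficients beyond the end of a list read as zero, so `h` has to fix zero.
coeff-map : (h : ℤ → ℤ) → h 0ℤ ≡ 0ℤ → ∀ f i → coeff (map h f) i ≡ h (coeff f i)
coeff-map h h0 []      i       = ≡.sym h0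
coeff-map h h0 (c ∷ f) zero    = ≡.refl
coeff-map h h0 (c ∷ f) (suc i) = coeff-map h h0 f i

-- Unlike _≈_, which unfolds to a family of equations between coefficients,
-- this record lets Agda infer the two polynomials.
infix 4 _≋_

record _≋_ (f g : ℤ[q]) : Set where
  constructor pointwise
  field at : f ≈ g

open _≋_ using (at)

-- `coeff` embeds polynomials in the pointwise group of integer sequences, injectively by the
-- definition of `_≋_`; the group laws are pulled back along it.
+-isAbelianGroup : IsAbelianGroup _≋_ _+_ 0# (-_)
+-isAbelianGroup = GroupMonomorphism.isAbelianGroup
  {G₂ = AbelianGroup.rawGroup coefficients}
  record
    { isGroupHomomorphism = record
      { isMonoidHomomorphism = record
        { isMagmaHomomorphism = record
          { isRelHomomorphism = record { cong = at }
          ; homo              = coeff-+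
          }
        ; ε-homo = λ _ → ≡.refl
        }
      ; ⁻¹-homo = coeff-map ℤ.-_ ≡.refl
      }
    ; injective = pointwise
    }
  (AbelianGroup.isAbelianGroup coefficients)
  where coefficients = Pointwise.abelianGroup ℕ ℤ.+-0-abelianGroup

+-abelianGroup : AbelianGroup 0ℓ 0ℓ
+-abelianGroup = record { isAbelianGroup = +-isAbelianGroup }

open AbelianGroup +-abelianGroup using (setoid; refl; sym; trans)
  renaming (∙-cong to +-cong; ∙-congˡ to +-congˡ; ∙-congʳ to +-congʳ; identityʳ to +-identityʳ)
open CommutativeSemigroupProperties (AbelianGroup.commutativeSemigroup +-abelianGroup)
  using (interchange; x∙yz≈y∙xz)

infixr 7 _·_

_·_ : ℤ → ℤ[q] → ℤ[q]
c · f = map (c ℤ.*_) f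

coeff-· : ∀ c f i → coeff (c · f) i ≡ c ℤ.* coeff f i
coeff-· c = coeff-map (c ℤ.*_) (ℤ.*-zeroʳ c)

∷-cong : ∀ {c d f g} → c ≡ d → f ≋ g → c ∷ f ≋ d ∷ g
∷-cong c≡d f≈g .at zero    = c≡d
∷-cong c≡d f≈g .at (suc i) = f≈g .at i

0∷[]≈0# : 0ℤ ∷ [] ≋ 0#
0∷[]≈0# .at zero    = ≡.refl
0∷[]≈0# .at (suc i) = ≡.refl

·-congˡ : ∀ c {f g} → f ≋ g → c · f ≋ c · g
·-congˡ c {f} {g} f≈g .at i rewrite coeff-· c f i | coeff-· c g i = ≡.cong (c ℤ.*_) (f≈g .at i)

·-distribˡ-+ : ∀ c f g → c · (f + g) ≋ c · f + c · g
·-distribˡ-+ c f g .at i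
  rewrite coeff-· c (f + g) i | coeff-+ f g i | coeff-+ (c · f) (c · g) i | coeff-· c f i | coeff-· c g i
  = ℤ.*-distribˡ-+ c (coeff f i) (coeff g i)

·-distribʳ-+ : ∀ f c d → (c ℤ.+ d) · f ≋ c · f + d · f
·-distribʳ-+ f c d .at i
  rewrite coeff-· (c ℤ.+ d) f i | coeff-+ (c · f) (d · f) i | coeff-· c f i | coeff-· d f i
  = ℤ.*-distribʳ-+ (coeff f i) c d

·-assoc : ∀ c d f → (c ℤ.* d) · f ≋ c · d · f
·-assoc c d f .at i rewrite coeff-· (c ℤ.* d) f i | coeff-· c (d · f) i | coeff-· d f i = ℤ.*-assoc c d (coeff f i)

·-identityˡ : ∀ f → 1ℤ · f ≋ f
·-identityˡ f .at i = ≡.trans (coeff-· 1ℤ f i) (ℤ.*-identityˡ _)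

·-zeroˡ : ∀ f → 0ℤ · f ≋ 0#
·-zeroˡ f .at i = ≡.trans (coeff-· 0ℤ f i) (ℤ.*-zeroˡ (coeff f i))

open SetoidReasoning setoid

*-zeroʳ : ∀ f → f * 0# ≋ 0#
*-zeroʳ []      = refl
*-zeroʳ (c ∷ f) = trans (∷-cong ≡.refl (*-zeroʳ f)) 0∷[]≈0#

-- Multiplication recurses on its left factor; this mirror recursion on the right one yields
-- commutativity.
*-∷ʳ : ∀ f d g → f * (d ∷ g) ≋ d · f + (0ℤ ∷ f * g)
*-∷ʳ []      d g = sym 0∷[]≈0#
*-∷ʳ (c ∷ f) d g = ∷-cong (≡.cong (ℤ._+ 0ℤ) (ℤ.*-comm c d))
  (trans (+-congˡ (*-∷ʳ f d g)) (x∙yz≈y∙xz (c · g) (d · f) (0ℤ ∷ f * g)))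

*-comm : ∀ f g → f * g ≋ g * f
*-comm []      g = sym (*-zeroʳ g)
*-comm (c ∷ f) g = trans (+-congˡ (∷-cong ≡.refl (*-comm f g))) (sym (*-∷ʳ g c f))

*-congˡ : ∀ f {g h} → g ≋ h → f * g ≋ f * h
*-congˡ []      g≈h = refl
*-congˡ (c ∷ f) g≈h = +-cong (·-congˡ c g≈h) (∷-cong ≡.refl (*-congˡ f g≈h))

-- Equal polynomials may be lists of different lengths, so a change of the left factor is carried to
-- the right by commutativity.
*-cong : ∀ {f g h k} → f ≋ g → h ≋ k → f * h ≋ g * k
*-cong {f} {g} {h} {k} f≈g h≈k = begin
  f * h ≈⟨ *-congˡ f h≈k ⟩
  f * k ≈⟨ *-comm f k ⟩
  k * f ≈⟨ *-congˡ k f≈g ⟩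
  k * g ≈⟨ *-comm k g ⟩
  g * k ∎

*-distribʳ-+ : ∀ h f g → (f + g) * h ≋ f * h + g * h
*-distribʳ-+ h []      g       = refl
*-distribʳ-+ h (c ∷ f) []      = sym (+-identityʳ _)
*-distribʳ-+ h (c ∷ f) (d ∷ g) = begin
  (c ℤ.+ d) · h + (0ℤ ∷ (f + g) * h)
    ≈⟨ +-cong (·-distribʳ-+ h c d) (∷-cong ≡.refl (*-distribʳ-+ h f g)) ⟩
  (c · h + d · h) + ((0ℤ ∷ f * h) + (0ℤ ∷ g * h))
    ≈⟨ interchange (c · h) (d · h) (0ℤ ∷ f * h) (0ℤ ∷ g * h) ⟩
  (c ∷ f) * h + (d ∷ g) * h
    ∎

*-distribˡ-+ : ∀ h f g → h * (f + g) ≋ h * f + h * g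
*-distribˡ-+ h f g = begin
  h * (f + g)   ≈⟨ *-comm h (f + g) ⟩
  (f + g) * h   ≈⟨ *-distribʳ-+ h f g ⟩
  f * h + g * h ≈⟨ +-cong (*-comm f h) (*-comm g h) ⟩
  h * f + h * g ∎

·-*-assoc : ∀ c f g → (c · f) * g ≋ c · (f * g)
·-*-assoc c []      g = refl
·-*-assoc c (d ∷ f) g = begin
  (c ℤ.* d) · g + (0ℤ ∷ (c · f) * g)
    ≈⟨ +-cong (·-assoc c d g) (∷-cong (≡.sym (ℤ.*-zeroʳ c)) (·-*-assoc c f g)) ⟩
  c · d · g + c · (0ℤ ∷ f * g)
    ≈⟨ ·-distribˡ-+ c (d · g) (0ℤ ∷ f * g) ⟨
  c · ((d ∷ f) * g)
    ∎

0∷-* : ∀ f g → (0ℤ ∷ f) * g ≋ 0ℤ ∷ f * g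
0∷-* f g = +-congʳ (·-zeroˡ g)

-- Right distributivity separates the scaled and the shifted part of `(c ∷ f) * g`; multiplication
-- by `h` commutes with scaling and with shifting.
*-assoc : ∀ f g h → (f * g) * h ≋ f * (g * h)
*-assoc []      g h = refl
*-assoc (c ∷ f) g h = begin
  (c · g + (0ℤ ∷ f * g)) * h       ≈⟨ *-distribʳ-+ h (c · g) (0ℤ ∷ f * g) ⟩
  (c · g) * h + (0ℤ ∷ f * g) * h   ≈⟨ +-cong (·-*-assoc c g h) (0∷-* (f * g) h) ⟩
  c · (g * h) + (0ℤ ∷ (f * g) * h) ≈⟨ +-congˡ (∷-cong ≡.refl (*-assoc f g h)) ⟩
  (c ∷ f) * (g * h)                ∎

*-identityˡ : ∀ f → 1# * f ≋ f
*-identityˡ f = trans (+-cong (·-identityˡ f) 0∷[]≈0#) (+-identityʳ f)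

*-identityʳ : ∀ f → f * 1# ≋ f
*-identityʳ f = trans (*-comm f 1#) (*-identityˡ f)

isCommutativeRing : IsCommutativeRing _≋_ _+_ _*_ -_ 0# 1#
isCommutativeRing = record
  { isRing = record
    { +-isAbelianGroup = +-isAbelianGroup
    ; *-cong           = *-cong
    ; *-assoc          = *-assoc
    ; *-identity       = *-identityˡ , *-identityʳ
    ; distrib          = *-distribˡ-+ , *-distribʳ-+
    }
  ; *-comm = *-comm
  }

-- The identity map transports the laws from `_≋_` back to `_≈_`, the equality in which the theorem
-- is stated.
ℤ[q]-commutativeRing : CommutativeRing 0ℓ 0ℓ
ℤ[q]-commutativeRing = record
  { isCommutativeRing = RingMonomorphism.isCommutativeRing
    {R₁ = ℤ[q]-rawRing} {R₂ = CommutativeRing.rawRing (record { isCommutativeRing = isCommutativeRing })} {⟦_⟧ = id}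
    record
      { isRingHomomorphism = record
        { isSemiringHomomorphism = record
          { isNearSemiringHomomorphism = record
            { +-isMonoidHomomorphism = record
              { isMagmaHomomorphism = record
                { isRelHomomorphism = record { cong = pointwise }
                ; homo              = λ _ _ → refl
                }
              ; ε-homo = refl
              }
            ; *-homo = λ _ _ → refl
            }
          ; 1#-homo = refl
          }
        ; -‿homo = λ _ → refl
        }
      ; injective = at
      }
    isCommutativeRing
  }

-- Specialisation to the biperiodic sequence.

open Alternating (CommutativeRing.commutativeSemiring ℤ[q]-commutativeRing) using (factor)

const-leading : ∀ a b n → const (leading a b n) ≡ factor (const a) (const b) (parity n)
const-leading a b n with parity n
... | 0ℙ = ≡.refl
... | 1ℙ = ≡.refl

theorem13 : (a b : ℕ) .{{_ : NonZero a}} .{{_ : NonZero b}} (n : ℕ) →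
    ∑[1≤ k ≤ n ℕ.+ 1 ] (q ^ k * F a b k
    * const a ^ (ξ n ℕ.* ξ k)
    * const b ^ (ξ (k ℕ.+ 1) ℕ.∸ ξ n ℕ.* ξ (k ℕ.+ 1))
    * (const a * const b) ^ ⌊ (n ℕ.+ 1) ℕ.∸ k /2⌋)
    ≈ F a b (n ℕ.+ 3) - const a ^ ξ n * (const a * const b) ^ ⌊ n ℕ.+ 2 /2⌋
theorem13 a b n rewrite ℕ.+-comm n 1 | ℕ.+-comm n 2 | ℕ.+-comm n 3 =
  biperiodic-sum ℤ[q]-commutativeRing (const a) (const b) q (F a b) (at F₂) F₊ n
  where
  F₂ : F a b 2 ≋ const a
  F₂ = trans (+-cong (*-identityʳ (const a)) (*-zeroʳ (q ^ 0))) (+-identityʳ (const a))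

  F₊ : ∀ m → F a b (suc (suc (suc m)))
    ≈ factor (const a) (const b) (parity (suc m)) * F a b (suc (suc m)) + q ^ suc m * F a b (suc m)
  -- `parity` reduces by two successors at a time, so the indices `m + 3` and `m + 1` select the
  -- same coefficient.
  F₊ m i = ≡.cong (λ c → coeff (c * F a b (suc (suc m)) + q ^ suc m * F a b (suc m)) i)
    (const-leading a b (suc (suc (suc m))))
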